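{- Let $C=(1,c_2,c_3,c_4,c_5,c_6)$ be a system and $\ell=\lceil c_5/c_3\rceil$, and suppose $C$ satisfies (a), (b), or (c): (a) $C=(1,2,3,c_4,c_4+1,2c_4)$ and $c_4>4$; (b) $C=(1,c_2,2c_2-1,c_4,c_2+c_4-1,2c_4-1)$, $c_4\ge 3c_2-1$, $\mathrm{grd}_C(\ell c_3)\le\ell$, and $\mathrm{grd}_C(\ell c_3)=\ell c_3-c_5+1-\lfloor(\ell c_3-c_5)/c_2\rfloor(c_2-1)$; (c) $C=(1,c_2,2c_2,c_4,c_2+c_4,2c_4)$, $c_4\ge 3c_2-1$, $c_4\ne 3c_2$, $\mathrm{grd}_C(\ell c_3)\le\ell$, and $\mathrm{grd}_C(\ell c_3)=\ell c_3-c_5+1-\lfloor(\ell c_3-c_5)/c_2\rfloor(c_2-1)$. Then $C$ is canonical and the subsystem $(1,c_2,c_3,c_4,c_5)$ is noncanonical.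
   Context: A system is a tuple $C=(c_1,\dots,c_n)$ of integers with $1=c_1<c_2<\dots<c_n$; for $k\le n$, $(c_1,\dots,c_k)$ is a subsystem. For a positive integer $v$, $\mathrm{opt}_C(v)$ is the minimum of $\sum_i x_i$ over $x\in\mathbb{Z}_{\ge0}^n$ with $\sum_i c_ix_i=v$. The greedy representation of $v$ is produced by: for $i=n$ down to $1$, while $c_i\le$ remaining value, take a coin $c_i$. $\mathrm{grd}_C(v)$ is its number of coins. A positive integer $w$ is a counterexample if $\mathrm{opt}_C(w)<\mathrm{grd}_C(w)$; $C$ is canonical if it has none, noncanonical otherwise. -}

module Defs where

open import Data.Fin.Base as Fin using (Fin; zero; suc; inject≤)
open import Data.Fin.Properties using (toℕ-inject≤)
open import Data.Nat.Base using (ℕ; zero; suc; _+_; _*_; _∸_; _≤_; _<_; z≤n; s≤s; NonZero; >-nonZero)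
open import Data.Nat.DivMod using (_/_; _%_)
open import Data.Nat.Properties using (≤-<-trans)
open import Data.Product.Base using (∃-syntax; _×_; _,_; proj₂)
open import Data.Vec.Base using (Vec; []; _∷_; head; lookup; sum; truncate; zipWith)
open import Data.Vec.Properties using (lookup-truncate)
open import Relation.Binary.PropositionalEquality using (_≡_; refl; sym; subst₂)
open import Relation.Nullary.Negation using (¬_)

private
  variable
    m n : ℕ

record IsSystem (C : Vec ℕ (suc n)) : Set where
  field
    first      : head C ≡ 1
    increasing : ∀ {i j} → i Fin.< j → lookup C i < lookup C j

open IsSystem

coin-nonZero : {C : Vec ℕ (suc n)} → IsSystem C → ∀ i → NonZero (lookup C i)
coin-nonZero {C = _ ∷ _} S zero with refl ← first S = _
coin-nonZero S (suc i) = >-nonZero (≤-<-trans z≤n (increasing S {zero} {suc i} (s≤s z≤n)))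

subsystem-isSystem : {C : Vec ℕ (suc n)} (m≤n : suc m ≤ suc n) → IsSystem C → IsSystem (truncate m≤n C)
subsystem-isSystem {C = _ ∷ _} (s≤s _) S .first = first S
subsystem-isSystem {C = C} m≤n S .increasing {i} {j} i<j =
  subst₂ _<_ (sym (lookup-truncate m≤n C i)) (sym (lookup-truncate m≤n C j))
    (increasing S (subst₂ _<_ (sym (toℕ-inject≤ i m≤n)) (sym (toℕ-inject≤ j m≤n)) i<j))

-- x has lookup x i copies of the coin lookup C i.
value : Vec ℕ n → Vec ℕ n → ℕ
value C x = sum (zipWith _*_ C x)

-- "opt_C(v) = k", i.e. k is the minimum of the set { Σ xᵢ ∣ Σ cᵢ xᵢ = v }.
IsOpt : Vec ℕ n → ℕ → ℕ → Set
IsOpt {n} C v k =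
  (∃[ x ] value C x ≡ v × sum x ≡ k) ×
  ((x : Vec ℕ n) → value C x ≡ v → k ≤ sum x)

-- Coins are stored in increasing order, so the tail (the larger coins) is
-- processed first.  With r remaining, the loop "while c ≤ r, take a coin c"
-- takes r / c coins and leaves r % c.  The result is the final remainder
-- together with the number of coins taken of each kind.
greedy : (C : Vec ℕ n) → .(∀ i → NonZero (lookup C i)) → ℕ → ℕ × Vec ℕ n
greedy []       _  v = v , []
greedy (c ∷ cs) nz v =
  let r , x = greedy cs (λ i → nz (suc i)) v
  in (r % c) {{nz zero}} , (r / c) {{nz zero}} ∷ x

grd : (C : Vec ℕ (suc n)) .{{_ : IsSystem C}} → ℕ → ℕ
grd C {{S}} v = sum (proj₂ (greedy C (coin-nonZero S) v))

Counterexample : (C : Vec ℕ (suc n)) .{{_ : IsSystem C}} → ℕ → Set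
Counterexample C w = 0 < w × ∃[ k ] IsOpt C w k × k < grd C w

Canonical : (C : Vec ℕ (suc n)) .{{_ : IsSystem C}} → Set
Canonical C = ∀ w → ¬ Counterexample C w

Noncanonical : (C : Vec ℕ (suc n)) .{{_ : IsSystem C}} → Set
Noncanonical C = ∃[ w ] Counterexample C w

⌈_/_⌉ : (a b : ℕ) .{{_ : NonZero b}} → ℕ
⌈ a / b ⌉ = (a + (b ∸ 1)) / b

{-# OPTIONS --safe #-}

-- All three families have the shape c₃ = c₂ + u, c₅ = c₄ + u, c₆ = 2 c₄ - w with
-- c₂ ∈ {u, u + 1}, and each of w, w + u, w + 2 u is 0 or one of the coins 1, c₂, c₃.
-- Let g be the greedy count for (1, c₂, c₃), which is subadditive.  The bound
-- grd (ℓ c₃) ≤ ℓ says g d < ℓ for d = ℓ c₃ - c₅, and since g (x + ℓ c₃) = g x + ℓ,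
-- subadditivity gives g x < g (x + c₅): taking c₅ always beats the small coins.
-- Two coins from {c₄, c₅} can be exchanged for c₆ and at most one small coin, so only
-- representations with at most one of them compete with greedy, and these lose by
-- the inequality above.  In the subsystem without c₆, the value 2 c₄ is a
-- counterexample: greedy starts with c₅ and needs at least two more coins.
module Submission where

open import Defs
open import Data.Empty using (⊥-elim)
open import Data.Fin using (#_; zero; suc)
open import Data.Nat.Base using (ℕ; zero; suc; _+_; _*_; _∸_; _≤_; _<_; _≥_; _>_; z≤n; s≤s; s≤s⁻¹; NonZero)
open import Data.Nat.Divisibility using (∣-refl)
open import Data.Nat.DivMod using (_/_; _%_; m<n⇒m/n≡0; m<n⇒m%n≡m; +-distrib-/-∣ˡ; n/n≡1; [m+n]%n≡m%n; n/1≡n; m≡m%n+[m/n]*n; m%n<n; m/n*n≤m)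
open import Data.Nat.Induction using (<-rec)
open import Data.Nat.Properties
open import Data.Nat.Tactic.RingSolver using (solve-∀)
open import Data.Product.Base using (∃-syntax; _×_; _,_; proj₁; proj₂)
open import Data.Sum.Base using (_⊎_; inj₁; inj₂; [_,_]′)
open import Data.Vec.Base using (Vec; []; _∷_; lookup; sum)
open import Function.Base using (id)
open import Relation.Binary.PropositionalEquality using (_≡_; _≢_; refl; sym; trans; cong; cong₂; subst; module ≡-Reasoning)

-- Greedy counts as nested functions

-- The greedy count when c is the largest coin and f counts for the remaining coins.
spend : (c : ℕ) .{{_ : NonZero c}} → (ℕ → ℕ) → ℕ → ℕ
spend c f v = v / c + f (v % c)

spend-< : ∀ {c} .{{_ : NonZero c}} f {v} → v < c → spend c f v ≡ f v
spend-< f v<c = cong₂ _+_ (m<n⇒m/n≡0 v<c) (cong f (m<n⇒m%n≡m v<c))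

spend-+ : ∀ c .{{_ : NonZero c}} f v → spend c f (c + v) ≡ suc (spend c f v)
spend-+ c f v = cong₂ _+_
  (trans (+-distrib-/-∣ˡ v ∣-refl) (cong (_+ v / c) (n/n≡1 c)))
  (cong f (trans (cong (_% c) (+-comm c v)) ([m+n]%n≡m%n v c)))

-- The accumulator `f` is wrapped by smaller coins first, so the largest coin ends up outermost. On
-- an explicit list of coins this unfolds by computation to the nested `spend`s used below.
spendAll : ∀ {n} (cs : Vec ℕ n) → .(∀ i → NonZero (lookup cs i)) → (ℕ → ℕ) → ℕ → ℕ
spendAll []       _  f = f
spendAll (c ∷ cs) nz f = spendAll cs (λ i → nz (suc i)) (spend c {{nz zero}} f)

-- Here `f` prices the remainder that the coins `cs` leave over. In the induction the smallest coin
-- moves from the vector of counts into this price.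
greedy-spendAll : ∀ {n} (cs : Vec ℕ n) .(nz : ∀ i → NonZero (lookup cs i)) f v →
  let r , x = greedy cs nz v in f r + sum x ≡ spendAll cs nz f v
greedy-spendAll []       _  f v = +-identityʳ (f v)
greedy-spendAll (c ∷ cs) nz f v = 
  trans (regroup (f _) (_/_ (proj₁ (greedy cs (λ i → nz (suc i)) v)) c {{nz zero}}) _)
        (greedy-spendAll cs (λ i → nz (suc i)) (spend c {{nz zero}} f) v)
  where
  regroup : ∀ i j k → i + (j + k) ≡ (j + i) + k
  regroup = solve-∀

grd-spendAll : ∀ {n} (cs : Vec ℕ n) {{S : IsSystem (1 ∷ cs)}} v →
  grd (1 ∷ cs) v ≡ spendAll cs (λ i → coin-nonZero S (suc i)) id v
-- The coin 1 takes the whole remainder, so the remainder is priced by `id`.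
grd-spendAll cs {{S}} v = trans (cong (_+ sum (proj₂ rx)) (n/1≡n (proj₁ rx))) (greedy-spendAll cs nz id v)
  where
  nz : ∀ i → NonZero (lookup cs i)
  nz i = coin-nonZero S (suc i)
  rx = greedy cs nz v

-- Elementary inequalities

<-or-+ : ∀ m n → n < m ⊎ (∃[ k ] n ≡ m + k)
<-or-+ m n with <-≤-connex n m
... | inj₁ n<m = inj₁ n<m
... | inj₂ m≤n = inj₂ (n ∸ m , sym (m+[n∸m]≡n m≤n))

iterate-≤ : ∀ (f : ℕ → ℕ) {m} → (∀ x → f (m + x) ≤ suc (f x)) → ∀ k x → f (k * m + x) ≤ k + f x
iterate-≤ f     f-≤ zero    x = ≤-refl
iterate-≤ f {m} f-≤ (suc k) x = begin
  f (m + k * m + x)   ≡⟨ cong f (+-assoc m (k * m) x) ⟩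
  f (m + (k * m + x)) ≤⟨ f-≤ (k * m + x) ⟩
  suc (f (k * m + x)) ≤⟨ s≤s (iterate-≤ f f-≤ k x) ⟩
  suc k + f x         ∎
  where open ≤-Reasoning

value-≤ : ∀ {n} (C x : Vec ℕ n) M → (∀ i → lookup C i ≤ M) → value C x ≤ M * sum x
value-≤ []      []      M C≤M = z≤n
value-≤ (c ∷ C) (k ∷ x) M C≤M = begin
  c * k + value C x ≤⟨ +-mono-≤ (*-monoˡ-≤ k (C≤M zero)) (value-≤ C x M (λ i → C≤M (suc i))) ⟩
  M * k + M * sum x ≡⟨ *-distribˡ-+ M k (sum x) ⟨
  M * (k + sum x)   ∎
  where open ≤-Reasoning

-- The system (1, a, c) with c equal to 2a or 2a - 1

module ThreeCoins
  (a u : ℕ) .{{_ : NonZero a}} .{{_ : NonZero (a + u)}}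
  (u>0 : 0 < u) (a≡u⊎a≡1+u : a ≡ u ⊎ a ≡ suc u)
  where

  c : ℕ
  c = a + u

  g : ℕ → ℕ
  g = spend c (spend a id)

  u≤a : u ≤ a
  u≤a = [ (λ a≡u → ≤-reflexive (sym a≡u)) , (λ a≡1+u → subst (u ≤_) (sym a≡1+u) (n≤1+n u)) ]′ a≡u⊎a≡1+u

  a≤1+u : a ≤ suc u
  a≤1+u = [ (λ a≡u → subst (_≤ suc u) (sym a≡u) (n≤1+n u)) , ≤-reflexive ]′ a≡u⊎a≡1+u

  a>0 : 0 < a
  a>0 = ≤-trans u>0 u≤a

  g-small : ∀ {x} → x < a → g x ≡ x
  g-small x<a = trans (spend-< (spend a id) (≤-trans x<a (m≤m+n a u))) (spend-< id x<a)

  g-middle : ∀ {x} → x < u → g (a + x) ≡ suc x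
  g-middle {x} x<u = begin
    g (a + x)              ≡⟨ spend-< (spend a id) (+-monoʳ-< a x<u) ⟩
    spend a id (a + x)     ≡⟨ spend-+ a id x ⟩
    suc (spend a id x)     ≡⟨ cong suc (spend-< id (<-≤-trans x<u u≤a)) ⟩
    suc x                  ∎
    where open ≡-Reasoning

  g-step : ∀ x → g (c + x) ≡ suc (g x)
  g-step = spend-+ c (spend a id)

  g-steps : ∀ k x → g (k * c + x) ≡ k + g x
  g-steps zero    x = refl
  g-steps (suc k) x = begin
    g (c + k * c + x)   ≡⟨ cong g (+-assoc c (k * c) x) ⟩
    g (c + (k * c + x)) ≡⟨ g-step (k * c + x) ⟩
    suc (g (k * c + x)) ≡⟨ cong suc (g-steps k x) ⟩
    suc (k + g x)       ∎
    where open ≡-Reasoning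

  -- The three premises follow the greedy algorithm: only ones below `a`, a single `a` and then ones
  -- between `a` and `c`, a first coin `c` from there on. In these ranges `g-small`, `g-middle` and
  -- `g-step` evaluate `g`.
  g-induction : (P : ℕ → Set) → (∀ {x} → x < a → P x) → (∀ {x} → x < u → P (a + x)) →
                (∀ x → P x → P (c + x)) → ∀ x → P x
  g-induction P small middle step = <-rec P body
    where
    body : ∀ x → (∀ {y} → y < x → P y) → P x
    body x rec with <-or-+ a x
    ... | inj₁ x<a = small x<a
    ... | inj₂ (y , refl) with <-or-+ u y
    ...   | inj₁ y<u = middle y<u
    ...   | inj₂ (t , refl) = subst P (+-assoc a u t)
              (step t (rec (subst (t <_) (+-assoc a u t) (m<n+m t (≤-trans a>0 (m≤m+n a u))))))

  g0≡0 : g 0 ≡ 0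
  g0≡0 = g-small a>0

  ga≡1 : g a ≡ 1
  ga≡1 = trans (cong g (sym (+-identityʳ a))) (g-middle u>0)

  gc≡1 : g c ≡ 1
  gc≡1 = trans (cong g (sym (+-identityʳ c))) (trans (g-step 0) (cong suc g0≡0))

  -- Inside a range the count grows by exactly one, and on reaching `a` or `c` it is 1.
  g-suc : ∀ x → g (suc x) ≤ suc (g x)
  g-suc = g-induction _ small middle step
    where
    open ≤-Reasoning
    small : ∀ {x} → x < a → g (suc x) ≤ suc (g x)
    small {x} x<a with m≤n⇒m<n∨m≡n x<a
    ... | inj₁ 1+x<a = ≤-reflexive (trans (g-small 1+x<a) (cong suc (sym (g-small x<a))))
    ... | inj₂ 1+x≡a = begin
      g (suc x) ≡⟨ cong g 1+x≡a ⟩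
      g a       ≡⟨ ga≡1 ⟩
      1         ≤⟨ s≤s z≤n ⟩
      suc (g x) ∎
    middle : ∀ {x} → x < u → g (suc (a + x)) ≤ suc (g (a + x))
    middle {x} x<u with m≤n⇒m<n∨m≡n x<u
    ... | inj₁ 1+x<u = begin
      g (suc (a + x)) ≡⟨ cong g (+-suc a x) ⟨
      g (a + suc x)   ≡⟨ g-middle 1+x<u ⟩
      suc (suc x)     ≡⟨ cong suc (g-middle x<u) ⟨
      suc (g (a + x)) ∎
    ... | inj₂ 1+x≡u = begin
      g (suc (a + x)) ≡⟨ cong g (+-suc a x) ⟨
      g (a + suc x)   ≡⟨ cong (λ y → g (a + y)) 1+x≡u ⟩
      g c             ≡⟨ gc≡1 ⟩
      1               ≤⟨ s≤s z≤n ⟩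
      suc (g (a + x)) ∎
    step : ∀ x → g (suc x) ≤ suc (g x) → g (suc (c + x)) ≤ suc (g (c + x))
    step x ih = begin
      g (suc (c + x)) ≡⟨ cong g (+-suc c x) ⟨
      g (c + suc x)   ≡⟨ g-step (suc x) ⟩
      suc (g (suc x)) ≤⟨ s≤s ih ⟩
      suc (suc (g x)) ≡⟨ cong suc (g-step x) ⟨
      suc (g (c + x)) ∎

  -- The shape of `c` matters here: 2a is `c` or `c + 1`, so a second `a` can be exchanged for `c`
  -- and at most one 1. In the first range the only sum not covered by `g-middle` is `a + u`, the
  -- coin `c` itself.
  g-+a : ∀ x → g (a + x) ≤ suc (g x)
  g-+a = g-induction _ small middle step
    where
    open ≤-Reasoning
    small : ∀ {x} → x < a → g (a + x) ≤ suc (g x)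
    small {x} x<a with m≤n⇒m<n∨m≡n (s≤s⁻¹ (≤-trans x<a a≤1+u))
    ... | inj₁ x<u = ≤-reflexive (trans (g-middle x<u) (cong suc (sym (g-small x<a))))
    ... | inj₂ x≡u = ≤-trans (≤-reflexive (trans (cong (λ y → g (a + y)) x≡u) gc≡1)) (s≤s z≤n)
    middle : ∀ {x} → x < u → g (a + (a + x)) ≤ suc (g (a + x))
    middle {x} x<u = subst (λ n → g (a + (a + x)) ≤ suc n) (sym (g-middle x<u)) (aux a≡u⊎a≡1+u)
      where
      aux : a ≡ u ⊎ a ≡ suc u → g (a + (a + x)) ≤ suc (suc x)
      aux (inj₁ a≡u) = begin
        g (a + (a + x)) ≡⟨ cong g (trans (cong (λ y → a + (y + x)) a≡u) (sym (+-assoc a u x))) ⟩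
        g (c + x)       ≡⟨ g-step x ⟩
        suc (g x)       ≡⟨ cong suc (g-small (<-≤-trans x<u u≤a)) ⟩
        suc x           ≤⟨ n≤1+n _ ⟩
        suc (suc x)     ∎
      aux (inj₂ a≡1+u) = begin
        g (a + (a + x))       ≡⟨ cong (λ y → g (a + (y + x))) a≡1+u ⟩
        g (a + (suc u + x))   ≡⟨ cong g (regroup a u x) ⟩
        g (c + suc x)         ≡⟨ g-step (suc x) ⟩
        suc (g (suc x))       ≡⟨ cong suc (g-small (subst (suc x <_) (sym a≡1+u) (s≤s x<u))) ⟩
        suc (suc x)           ∎
        where
        regroup : ∀ a u x → a + (suc u + x) ≡ a + u + suc x
        regroup = solve-∀
    step : ∀ x → g (a + x) ≤ suc (g x) → g (a + (c + x)) ≤ suc (g (c + x))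
    step x ih = begin
      g (a + (c + x)) ≡⟨ cong g (regroup a c x) ⟩
      g (c + (a + x)) ≡⟨ g-step (a + x) ⟩
      suc (g (a + x)) ≤⟨ s≤s ih ⟩
      suc (suc (g x)) ≡⟨ cong suc (g-step x) ⟨
      suc (g (c + x)) ∎
      where
      regroup : ∀ a c x → a + (c + x) ≡ c + (a + x)
      regroup = solve-∀

  g-+≤ : ∀ k x → g (k + x) ≤ k + g x
  g-+≤ k x = subst (λ y → g (y + x) ≤ k + g x) (*-identityʳ k) (iterate-≤ g g-suc k x)

  -- The greedy coins of `y` are added to `x` one at a time, and by `g-suc`, `g-+a` and `g-step`
  -- each raises the count by at most one.
  g-subadditive : ∀ y x → g (y + x) ≤ g y + g x
  g-subadditive y x = g-induction (λ y → g (y + x) ≤ g y + g x) small middle step y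
    where
    open ≤-Reasoning
    small : ∀ {y} → y < a → g (y + x) ≤ g y + g x
    small {y} y<a = subst (λ n → g (y + x) ≤ n + g x) (sym (g-small y<a)) (g-+≤ y x)
    middle : ∀ {y} → y < u → g (a + y + x) ≤ g (a + y) + g x
    middle {y} y<u = begin
      g (a + y + x)     ≡⟨ cong g (+-assoc a y x) ⟩
      g (a + (y + x))   ≤⟨ g-+a (y + x) ⟩
      suc (g (y + x))   ≤⟨ s≤s (g-+≤ y x) ⟩
      suc y + g x       ≡⟨ cong (_+ g x) (g-middle y<u) ⟨
      g (a + y) + g x   ∎
    step : ∀ y → g (y + x) ≤ g y + g x → g (c + y + x) ≤ g (c + y) + g x
    step y ih = begin
      g (c + y + x)     ≡⟨ cong g (+-assoc c y x) ⟩
      g (c + (y + x))   ≡⟨ g-step (y + x) ⟩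
      suc (g (y + x))   ≤⟨ s≤s ih ⟩
      suc (g y) + g x   ≡⟨ cong (_+ g x) (g-step y) ⟨
      g (c + y) + g x   ∎

  -- The condition `g y ≤ 1` encodes that `y` is 0 or one of the coins 1, a, c.
  g-coin : ∀ {y} → g y ≤ 1 → ∀ x → g (y + x) ≤ suc (g x)
  g-coin {y} gy≤1 x = ≤-trans (g-subadditive y x) (+-monoˡ-≤ (g x) gy≤1)

  -- This is the canonicity of (1, a, c): an arbitrary representation is stripped coin by coin.
  g-value : ∀ i j k → g (i * 1 + (j * a + (k * c + 0))) ≤ i + (j + k)
  g-value i j k = begin
    g (i * 1 + (j * a + (k * c + 0))) ≤⟨ iterate-≤ g g-suc i _ ⟩
    i + g (j * a + (k * c + 0))       ≤⟨ +-monoʳ-≤ i (iterate-≤ g g-+a j _) ⟩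
    i + (j + g (k * c + 0))           ≡⟨ cong (λ n → i + (j + n)) (g-steps k 0) ⟩
    i + (j + (k + g 0))               ≡⟨ cong (λ n → i + (j + (k + n))) g0≡0 ⟩
    i + (j + (k + 0))                 ≡⟨ cong (λ n → i + (j + n)) (+-identityʳ k) ⟩
    i + (j + k)                       ∎
    where open ≤-Reasoning

  -- `g` need not be monotone, but a shift by `u` is harmless. It turns a coin `a` into `c`. Below
  -- `a` it adds a coin `a` if `a = u`, and merges with one of the ones into a coin `a` if
  -- `a = u + 1`.
  g-mono-u : ∀ x → g x ≤ g (u + x)
  g-mono-u = g-induction _ (λ x<a → small x<a a≡u⊎a≡1+u) middle step
    where
    open ≤-Reasoning
    small : ∀ {x} → x < a → a ≡ u ⊎ a ≡ suc u → g x ≤ g (u + x)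
    small {x} x<a (inj₁ a≡u) = begin
      g x       ≡⟨ g-small x<a ⟩
      x         ≤⟨ n≤1+n x ⟩
      suc x     ≡⟨ g-middle (subst (x <_) a≡u x<a) ⟨
      g (a + x) ≡⟨ cong (λ y → g (y + x)) a≡u ⟩
      g (u + x) ∎
    small {zero}  _   (inj₂ _) = ≤-trans (≤-reflexive g0≡0) z≤n
    small {suc x} x<a (inj₂ a≡1+u) = begin
      g (suc x)     ≡⟨ g-small x<a ⟩
      suc x         ≡⟨ g-middle (s≤s⁻¹ (subst (suc x <_) a≡1+u x<a)) ⟨
      g (a + x)     ≡⟨ cong (λ y → g (y + x)) a≡1+u ⟩
      g (suc u + x) ≡⟨ cong g (+-suc u x) ⟨
      g (u + suc x) ∎
    middle : ∀ {x} → x < u → g (a + x) ≤ g (u + (a + x))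
    middle {x} x<u = begin
      g (a + x)       ≡⟨ g-middle x<u ⟩
      suc x           ≡⟨ cong suc (g-small (<-≤-trans x<u u≤a)) ⟨
      suc (g x)       ≡⟨ g-step x ⟨
      g (a + u + x)   ≡⟨ cong g (regroup a u x) ⟩
      g (u + (a + x)) ∎
      where
      regroup : ∀ a u x → a + u + x ≡ u + (a + x)
      regroup = solve-∀
    step : ∀ x → g x ≤ g (u + x) → g (c + x) ≤ g (u + (c + x))
    step x ih = begin
      g (c + x)       ≡⟨ g-step x ⟩
      suc (g x)       ≤⟨ s≤s ih ⟩
      suc (g (u + x)) ≡⟨ g-step (u + x) ⟨
      g (c + (u + x)) ≡⟨ cong g (regroup c u x) ⟩
      g (u + (c + x)) ∎
      where
      regroup : ∀ c u x → c + (u + x) ≡ u + (c + x)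
      regroup = solve-∀

  g-positive : ∀ x → 0 < x → 0 < g x
  g-positive = g-induction _
    (λ x<a x>0 → subst (0 <_) (sym (g-small x<a)) x>0)
    (λ x<u _ → subst (0 <_) (sym (g-middle x<u)) (s≤s z≤n))
    (λ x _ _ → subst (0 <_) (sym (g-step x)) (s≤s z≤n))

  g>1 : ∀ {x} → c < x → 1 < g x
  g>1 {x} c<x with <-or-+ c x
  ... | inj₁ x<c = ⊥-elim (<-asym c<x x<c)
  ... | inj₂ (y , refl) = subst (1 <_) (sym (g-step y)) (s≤s (g-positive y (+-cancelˡ-< c 0 y (subst (_< c + y) (sym (+-identityʳ c)) c<x))))

  -- The gain from taking a coin b + u or b

  module _ (b d ℓ : ℕ) (b+u+d≡ℓc : b + u + d ≡ ℓ * c) (gd<ℓ : g d < ℓ) where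

    g-gain : ∀ x → g x < g (b + u + x)
    g-gain x = +-cancelˡ-≤ (g d) _ _ (begin
      g d + suc (g x)       ≡⟨ +-suc (g d) (g x) ⟩
      suc (g d) + g x       ≤⟨ +-monoˡ-≤ (g x) gd<ℓ ⟩
      ℓ + g x               ≡⟨ g-steps ℓ x ⟨
      g (ℓ * c + x)         ≡⟨ cong (λ y → g (y + x)) b+u+d≡ℓc ⟨
      g (b + u + d + x)     ≡⟨ cong g (regroup (b + u) d x) ⟩
      g (d + (b + u + x))   ≤⟨ g-subadditive d (b + u + x) ⟩
      g d + g (b + u + x)   ∎)
      where
      open ≤-Reasoning
      regroup : ∀ D d x → D + d + x ≡ d + (D + x)
      regroup = solve-∀

    -- The range `t < u` is where greedy takes `b`, since from `b + u` on it prefers the next coin.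
    -- With ℓ = m + 1, the equation for ℓ c puts `b` at distance `d` below `m * c + a` if `d < a`,
    -- and at distance `f` below `m * c` if `d = a + f`. Then `g (b + t)` is computed explicitly,
    -- according to whether `b + t` reaches that mark.
    g-gain-b : d < c → ∀ {t} → t < u → g t < g (b + t)
    g-gain-b d<c {t} t<u = subst (_< g (b + t)) (sym (g-small (<-≤-trans t<u u≤a))) (by-d ℓ b+u+d≡ℓc gd<ℓ (<-or-+ a d))
      where
      open ≤-Reasoning
      by-d : ∀ ℓ → b + u + d ≡ ℓ * c → g d < ℓ → d < a ⊎ (∃[ f ] d ≡ a + f) → t < g (b + t)
      by-d (suc m) D+d≡ gd<1+m (inj₁ d<a) = by-t (<-or-+ d t)
        where
        d≤m : d ≤ m
        d≤m = subst (_≤ m) (g-small d<a) (s≤s⁻¹ gd<1+m)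
        b+d≡ : b + d ≡ m * c + a
        b+d≡ = +-cancelˡ-≡ u _ _ (trans (l u b d) (trans D+d≡ (r u a (m * c))))
          where
          l : ∀ u b d → u + (b + d) ≡ b + u + d
          l = solve-∀
          r : ∀ u a n → a + u + n ≡ u + (n + a)
          r = solve-∀
        by-t : t < d ⊎ (∃[ s ] t ≡ d + s) → t < g (b + t)
        by-t (inj₂ (s , refl)) = begin
          suc (d + s)          ≤⟨ s≤s (+-monoˡ-≤ s d≤m) ⟩
          suc (m + s)          ≡⟨ +-suc m s ⟨
          m + suc s            ≡⟨ cong (m +_) (g-middle (≤-<-trans (m≤n+m s d) t<u)) ⟨
          m + g (a + s)        ≡⟨ g-steps m (a + s) ⟨
          g (m * c + (a + s))  ≡⟨ cong g (+-assoc (m * c) a s) ⟨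
          g (m * c + a + s)    ≡⟨ cong (λ y → g (y + s)) b+d≡ ⟨
          g (b + d + s)        ≡⟨ cong g (+-assoc b d s) ⟩
          g (b + (d + s))      ∎
        -- Although `b + t` falls short of `m * c + a`, it still contains `m` coins `c`, and
        -- `t < d ≤ m`.
        by-t (inj₁ t<d) = begin-strict
          t                    <⟨ <-≤-trans t<d d≤m ⟩
          m                    ≤⟨ m≤m+n m z ⟩
          m + z                ≡⟨ cong (m +_) (g-small z<a) ⟨
          m + g z              ≡⟨ g-steps m z ⟨
          g (m * c + z)        ≡⟨ cong g b+t≡ ⟨
          g (b + t)            ∎
          where
          s z : ℕ
          s = d ∸ t
          z = a ∸ s
          s+t≡d : s + t ≡ d
          s+t≡d = m∸n+n≡m (<⇒≤ t<d)
          s<a : s < a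
          s<a = ≤-<-trans (m∸n≤m d t) d<a
          z+s≡a : z + s ≡ a
          z+s≡a = m∸n+n≡m (<⇒≤ s<a)
          z<a : z < a
          z<a = subst (z <_) z+s≡a (m<m+n z (m<n⇒0<n∸m t<d))
          b+t≡ : b + t ≡ m * c + z
          b+t≡ = +-cancelʳ-≡ s _ _ (begin-equality
            b + t + s       ≡⟨ +-assoc b t s ⟩
            b + (t + s)     ≡⟨ cong (b +_) (trans (+-comm t s) s+t≡d) ⟩
            b + d           ≡⟨ b+d≡ ⟩
            m * c + a       ≡⟨ cong (m * c +_) z+s≡a ⟨
            m * c + (z + s) ≡⟨ +-assoc (m * c) z s ⟨
            m * c + z + s   ∎)
      by-d (suc m) D+d≡ gd<1+m (inj₂ (f , d≡a+f)) = by-t m f<m b+f≡ (<-or-+ f t)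
        where
        f<u : f < u
        f<u = +-cancelˡ-< a f u (subst (_< c) d≡a+f d<c)
        f<m : f < m
        f<m = subst (_≤ m) (trans (cong g d≡a+f) (g-middle f<u)) (s≤s⁻¹ gd<1+m)
        b+f≡ : b + f ≡ m * c
        b+f≡ = +-cancelˡ-≡ c _ _ (trans (l a u b f) (trans (cong (b + u +_) (sym d≡a+f)) D+d≡))
          where
          l : ∀ a u b f → a + u + (b + f) ≡ b + u + (a + f)
          l = solve-∀
        by-t : ∀ m → f < m → b + f ≡ m * c → t < f ⊎ (∃[ s ] t ≡ f + s) → t < g (b + t)
        by-t m f<m b+f≡ (inj₂ (s , refl)) = begin
          suc (f + s)          ≤⟨ +-monoˡ-≤ s f<m ⟩
          m + s                ≡⟨ cong (m +_) (g-small (≤-<-trans (m≤n+m s f) (<-≤-trans t<u u≤a))) ⟨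
          m + g s              ≡⟨ g-steps m s ⟨
          g (m * c + s)        ≡⟨ cong (λ y → g (y + s)) b+f≡ ⟨
          g (b + f + s)        ≡⟨ cong g (+-assoc b f s) ⟩
          g (b + (f + s))      ∎
        -- Just short of `m * c`, where m = n + 1, greedy uses `n` coins `c`, one `a` and `z` ones.
        -- These are at least `m` coins, and `t < f < m`.
        by-t (suc n) f<m b+f≡ (inj₁ t<f) = begin
          suc t                    ≤⟨ s≤s (≤-trans (<⇒≤ t<f) (s≤s⁻¹ f<m)) ⟩
          suc n                    ≤⟨ m≤m+n (suc n) z ⟩
          suc n + z                ≡⟨ +-suc n z ⟨
          n + suc z                ≡⟨ cong (n +_) (g-middle z<u) ⟨
          n + g (a + z)            ≡⟨ g-steps n (a + z) ⟨
          g (n * c + (a + z))      ≡⟨ cong g b+t≡ ⟨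
          g (b + t)                ∎
          where
          s z : ℕ
          s = f ∸ t
          z = u ∸ s
          s+t≡f : s + t ≡ f
          s+t≡f = m∸n+n≡m (<⇒≤ t<f)
          z+s≡u : z + s ≡ u
          z+s≡u = m∸n+n≡m (≤-trans (m∸n≤m f t) (<⇒≤ f<u))
          z<u : z < u
          z<u = subst (z <_) z+s≡u (m<m+n z (m<n⇒0<n∸m t<f))
          regroup : ∀ n a z s → a + (z + s) + n ≡ n + (a + z) + s
          regroup = solve-∀
          b+t≡ : b + t ≡ n * c + (a + z)
          b+t≡ = +-cancelʳ-≡ s _ _ (begin-equality
            b + t + s           ≡⟨ +-assoc b t s ⟩
            b + (t + s)         ≡⟨ cong (b +_) (trans (+-comm t s) s+t≡f) ⟩
            b + f               ≡⟨ b+f≡ ⟩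
            c + n * c           ≡⟨ cong (λ y → a + y + n * c) z+s≡u ⟨
            a + (z + s) + n * c ≡⟨ regroup (n * c) a z s ⟩
            n * c + (a + z) + s ∎)

    -- Greedy with the coins b, D and E added

    module SixCoins
      (z w : ℕ) .{{_ : NonZero b}} .{{_ : NonZero (b + u)}} .{{_ : NonZero (b + u + z)}}
      (d<c : d < c) (z>0 : 0 < z) (b≡u+z+w : b ≡ u + z + w)
      (gw≤1 : g w ≤ 1) (g[w+u]≤1 : g (w + u) ≤ 1) (g[w+2u]≤1 : g (w + u + u) ≤ 1)
      where

      D E : ℕ
      D = b + u
      E = b + u + z

      h₅ h : ℕ → ℕ
      h₅ = spend D (spend b g)
      h = spend E h₅

      z+w<b : z + w < b
      z+w<b = subst (z + w <_) (sym (trans b≡u+z+w (+-assoc u z w))) (m<n+m (z + w) u>0)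

      z<b : z < b
      z<b = ≤-<-trans (m≤m+n z w) z+w<b

      u<b : u < b
      u<b = subst (u <_) (sym b≡u+z+w) (<-≤-trans (m<m+n u z>0) (m≤m+n (u + z) w))

      b≤D : b ≤ D
      b≤D = m≤m+n b u

      D≤E : D ≤ E
      D≤E = m≤m+n D z

      h₅-D : ∀ {x} → x < b → h₅ (D + x) ≡ suc (g x)
      h₅-D {x} x<b = begin
        h₅ (D + x)   ≡⟨ spend-+ D (spend b g) x ⟩
        suc (h₅ x)   ≡⟨ cong suc (spend-< (spend b g) (<-≤-trans x<b b≤D)) ⟩
        suc (spend b g x) ≡⟨ cong suc (spend-< g x<b) ⟩
        suc (g x)    ∎
        where open ≡-Reasoning

      h-small : ∀ {x} → x < b → h x ≡ g x
      h-small {x} x<b = begin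
        h x         ≡⟨ spend-< h₅ (<-≤-trans x<b (≤-trans b≤D D≤E)) ⟩
        h₅ x        ≡⟨ spend-< (spend b g) (<-≤-trans x<b b≤D) ⟩
        spend b g x ≡⟨ spend-< g x<b ⟩
        g x         ∎
        where open ≡-Reasoning

      h-b : ∀ {x} → x < u → h (b + x) ≡ suc (g x)
      h-b {x} x<u = begin
        h (b + x)         ≡⟨ spend-< h₅ (<-≤-trans b+x<D D≤E) ⟩
        h₅ (b + x)        ≡⟨ spend-< (spend b g) b+x<D ⟩
        spend b g (b + x) ≡⟨ spend-+ b g x ⟩
        suc (spend b g x) ≡⟨ cong suc (spend-< g (<-trans x<u u<b)) ⟩
        suc (g x)         ∎
        where
        open ≡-Reasoning
        b+x<D : b + x < D
        b+x<D = +-monoʳ-< b x<u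

      h-D : ∀ {x} → x < z → h (D + x) ≡ suc (g x)
      h-D x<z = trans (spend-< h₅ (+-monoʳ-< D x<z)) (h₅-D (<-trans x<z z<b))

      h-E : ∀ x → h (E + x) ≡ suc (h x)
      h-E = spend-+ E h₅

      -- Since D = (w + 2u) + z and w + 2u is at most one coin, replacing the shift by D with the
      -- shift by z loses at most one. The strict inequality of `g-gain` thus leaves a weak one. It
      -- pays for greedy's taking E where a representation uses D.
      g-mono-E∸D : ∀ x → g x ≤ g (z + x)
      g-mono-E∸D x = s≤s⁻¹ (begin
        suc (g x)                   ≤⟨ g-gain x ⟩
        g (b + u + x)               ≡⟨ cong (λ y → g (y + u + x)) b≡u+z+w ⟩
        g (u + z + w + u + x)       ≡⟨ cong g (regroup u z w x) ⟩
        g (w + u + u + (z + x))     ≤⟨ g-coin g[w+2u]≤1 (z + x) ⟩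
        suc (g (z + x))             ∎)
        where
        open ≤-Reasoning
        regroup : ∀ u z w x → u + z + w + u + x ≡ w + u + u + (z + x)
        regroup = solve-∀

      -- The same argument with D = (w + u) + (u + z), for E taken in place of `b`.
      g-mono-E∸b : ∀ x → g x ≤ g (u + (z + x))
      g-mono-E∸b x = s≤s⁻¹ (begin
        suc (g x)                   ≤⟨ g-gain x ⟩
        g (b + u + x)               ≡⟨ cong (λ y → g (y + u + x)) b≡u+z+w ⟩
        g (u + z + w + u + x)       ≡⟨ cong g (regroup u z w x) ⟩
        g (w + u + (u + (z + x)))   ≤⟨ g-coin g[w+u]≤1 (u + (z + x)) ⟩
        suc (g (u + (z + x)))       ∎)
        where
        open ≤-Reasoning
        regroup : ∀ u z w x → u + z + w + u + x ≡ w + u + (u + (z + x))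
        regroup = solve-∀

      -- The first large coin taken by greedy costs one, and the gain inequalities show that `g` of
      -- what is left is smaller by at least one. For E the shift by `z` is followed by the gain of
      -- D.
      h≤g : ∀ x → h x ≤ g x
      h≤g = <-rec _ body
        where
        open ≤-Reasoning
        body : ∀ x → (∀ {y} → y < x → h y ≤ g y) → h x ≤ g x
        body x rec with <-or-+ E x
        ... | inj₂ (t , refl) = begin
          h (E + t)             ≡⟨ h-E t ⟩
          suc (h t)             ≤⟨ s≤s (rec (m<n+m t (≤-trans z>0 (m≤n+m z D)))) ⟩
          suc (g t)             ≤⟨ s≤s (g-mono-E∸D t) ⟩
          suc (g (z + t))       ≤⟨ g-gain (z + t) ⟩
          g (D + (z + t))       ≡⟨ cong g (+-assoc D z t) ⟨
          g (E + t)             ∎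
        ... | inj₁ x<E with <-or-+ D x
        ...   | inj₂ (t , refl) = ≤-trans (≤-reflexive (h-D (+-cancelˡ-< D t z x<E))) (g-gain t)
        ...   | inj₁ x<D with <-or-+ b x
        ...     | inj₂ (t , refl) = ≤-trans (≤-reflexive (h-b t<u)) (g-gain-b d<c t<u)
          where
          t<u : t < u
          t<u = +-cancelˡ-< b t u x<D
        ...     | inj₁ x<b = ≤-reflexive (h-small x<b)

      h-E≤ : ∀ x → h (E + x) ≤ suc (g x)
      h-E≤ x = ≤-trans (≤-reflexive (h-E x)) (s≤s (h≤g x))

      -- If `x ≥ z`, greedy takes E instead of D and is left with `z` less, which costs no more by
      -- `g-mono-E∸D`.
      h-D≤ : ∀ x → h (D + x) ≤ suc (g x)
      h-D≤ x with <-or-+ z x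
      ... | inj₁ x<z = ≤-reflexive (h-D x<z)
      ... | inj₂ (t , refl) = begin
        h (D + (z + t))   ≡⟨ cong h (+-assoc D z t) ⟨
        h (E + t)         ≤⟨ h-E≤ t ⟩
        suc (g t)         ≤⟨ s≤s (g-mono-E∸D t) ⟩
        suc (g (z + t))   ∎
        where open ≤-Reasoning

      -- Greedy may start with `b`, D or E. In the last two cases its remainder is smaller than `x`
      -- by `u` or by `u + z`, and the matching shift inequality applies.
      h-b≤ : ∀ x → h (b + x) ≤ suc (g x)
      h-b≤ x with <-or-+ u x
      ... | inj₁ x<u = ≤-reflexive (h-b x<u)
      ... | inj₂ (y , refl) with <-or-+ z y
      ...   | inj₁ y<z = begin
        h (b + (u + y))   ≡⟨ cong h (+-assoc b u y) ⟨
        h (D + y)         ≡⟨ h-D y<z ⟩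
        suc (g y)         ≤⟨ s≤s (g-mono-u y) ⟩
        suc (g (u + y))   ∎
        where open ≤-Reasoning
      ...   | inj₂ (t , refl) = begin
        h (b + (u + (z + t)))   ≡⟨ cong h (regroup b u z t) ⟩
        h (E + t)               ≤⟨ h-E≤ t ⟩
        suc (g t)               ≤⟨ s≤s (g-mono-E∸b t) ⟩
        suc (g (u + (z + t)))   ∎
        where
        open ≤-Reasoning
        regroup : ∀ b u z t → b + (u + (z + t)) ≡ b + u + z + t
        regroup = solve-∀

      h-Es : ∀ q x → h (q * E + x) ≡ q + h x
      h-Es zero    x = refl
      h-Es (suc q) x = trans (cong h (+-assoc E (q * E) x)) (trans (h-E (q * E + x)) (cong suc (h-Es q x)))

      -- So `w` is the excess of 2b over E, and the assumption on `b` is this equation with one `b`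
      -- cancelled.
      2b≡E+w : b + b ≡ E + w
      2b≡E+w = trans (cong (b +_) b≡u+z+w) (regroup b u z w)
        where
        regroup : ∀ b u z w → b + (u + z + w) ≡ b + u + z + w
        regroup = solve-∀

      -- b + b, b + D and D + D each equal E plus at most one coin of {1, a, c}, so
      -- pairs of middle coins can be traded away until at most one of them is left.
      h-pairs : ∀ p s q x → h (p * b + s * D + q * E + x) ≤ p + s + q + g x
      h-pairs 0 0 q x = begin
        h (q * E + x) ≡⟨ h-Es q x ⟩
        q + h x       ≤⟨ +-monoʳ-≤ q (h≤g x) ⟩
        q + g x       ∎
        where open ≤-Reasoning
      h-pairs 1 0 q x = begin
        h (b + 0 + 0 + q * E + x) ≡⟨ cong h (regroup b (q * E) x) ⟩
        h (q * E + (b + x))       ≡⟨ h-Es q (b + x) ⟩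
        q + h (b + x)             ≤⟨ +-monoʳ-≤ q (h-b≤ x) ⟩
        q + suc (g x)             ≡⟨ +-suc q (g x) ⟩
        suc (q + g x)             ∎
        where
        open ≤-Reasoning
        regroup : ∀ b n x → b + 0 + 0 + n + x ≡ n + (b + x)
        regroup = solve-∀
      h-pairs 0 1 q x = begin
        h (D + 0 + q * E + x)     ≡⟨ cong h (regroup D (q * E) x) ⟩
        h (q * E + (D + x))       ≡⟨ h-Es q (D + x) ⟩
        q + h (D + x)             ≤⟨ +-monoʳ-≤ q (h-D≤ x) ⟩
        q + suc (g x)             ≡⟨ +-suc q (g x) ⟩
        suc (q + g x)             ∎
        where
        open ≤-Reasoning
        regroup : ∀ D n x → D + 0 + n + x ≡ n + (D + x)
        regroup = solve-∀
      h-pairs (suc (suc p)) s q x = begin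
        h ((b + (b + p * b)) + s * D + q * E + x)     ≡⟨ cong h (l b (p * b) (s * D) (q * E) x) ⟩
        h ((b + b) + (p * b + s * D + q * E + x))     ≡⟨ cong (λ y → h (y + (p * b + s * D + q * E + x))) 2b≡E+w ⟩
        h ((E + w) + (p * b + s * D + q * E + x))     ≡⟨ cong h (r E w (p * b) (s * D) (q * E) x) ⟩
        h (p * b + s * D + suc q * E + (w + x))       ≤⟨ h-pairs p s (suc q) (w + x) ⟩
        p + s + suc q + g (w + x)                     ≤⟨ +-monoʳ-≤ (p + s + suc q) (g-coin gw≤1 x) ⟩
        p + s + suc q + suc (g x)                     ≡⟨ count p s q (g x) ⟩
        suc (suc p) + s + q + g x                     ∎
        where
        open ≤-Reasoning
        l : ∀ b i j k x → (b + (b + i)) + j + k + x ≡ (b + b) + (i + j + k + x)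
        l = solve-∀
        r : ∀ E w i j k x → (E + w) + (i + j + k + x) ≡ i + j + (E + k) + (w + x)
        r = solve-∀
        count : ∀ p s q n → p + s + suc q + suc n ≡ suc (suc p) + s + q + n
        count = solve-∀
      h-pairs (suc p) (suc s) q x = begin
        h ((b + p * b) + (D + s * D) + q * E + x)     ≡⟨ cong h (l b u (p * b) (s * D) (q * E) x) ⟩
        h ((b + b) + u + (p * b + s * D + q * E + x)) ≡⟨ cong (λ y → h (y + u + (p * b + s * D + q * E + x))) 2b≡E+w ⟩
        h ((E + w) + u + (p * b + s * D + q * E + x)) ≡⟨ cong h (r E w u (p * b) (s * D) (q * E) x) ⟩
        h (p * b + s * D + suc q * E + (w + u + x))   ≤⟨ h-pairs p s (suc q) (w + u + x) ⟩
        p + s + suc q + g (w + u + x)                 ≤⟨ +-monoʳ-≤ (p + s + suc q) (g-coin g[w+u]≤1 x) ⟩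
        p + s + suc q + suc (g x)                     ≡⟨ count p s q (g x) ⟩
        suc p + suc s + q + g x                       ∎
        where
        open ≤-Reasoning
        l : ∀ b u i j k x → (b + i) + (b + u + j) + k + x ≡ (b + b) + u + (i + j + k + x)
        l = solve-∀
        r : ∀ E w u i j k x → (E + w) + u + (i + j + k + x) ≡ i + j + (E + k) + (w + u + x)
        r = solve-∀
        count : ∀ p s q n → p + s + suc q + suc n ≡ suc p + suc s + q + n
        count = solve-∀
      h-pairs 0 (suc (suc s)) q x = begin
        h ((D + (D + s * D)) + q * E + x)         ≡⟨ cong h (l b u (s * D) (q * E) x) ⟩
        h ((b + b) + u + u + (s * D + q * E + x)) ≡⟨ cong (λ y → h (y + u + u + (s * D + q * E + x))) 2b≡E+w ⟩
        h ((E + w) + u + u + (s * D + q * E + x)) ≡⟨ cong h (r E w u (s * D) (q * E) x) ⟩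
        h (s * D + suc q * E + (w + u + u + x))   ≤⟨ h-pairs 0 s (suc q) (w + u + u + x) ⟩
        s + suc q + g (w + u + u + x)             ≤⟨ +-monoʳ-≤ (s + suc q) (g-coin g[w+2u]≤1 x) ⟩
        s + suc q + suc (g x)                     ≡⟨ count s q (g x) ⟩
        suc (suc s) + q + g x                     ∎
        where
        open ≤-Reasoning
        l : ∀ b u j k x → (b + u + (b + u + j)) + k + x ≡ (b + b) + u + u + (j + k + x)
        l = solve-∀
        r : ∀ E w u j k x → (E + w) + u + u + (j + k + x) ≡ j + (E + k) + (w + u + u + x)
        r = solve-∀
        count : ∀ s q n → s + suc q + suc n ≡ suc (suc s) + q + n
        count = solve-∀

      -- A representation splits into large and small coins: `h-pairs` handles the large ones and
      -- `g-value` the rest.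
      h-value : ∀ x → h (value (1 ∷ a ∷ c ∷ b ∷ D ∷ E ∷ []) x) ≤ sum x
      h-value (i ∷ j ∷ k ∷ p ∷ s ∷ q ∷ []) = begin
        h (1 * i + (a * j + (c * k + (b * p + (D * s + (E * q + 0))))))          ≡⟨ cong h (reorder a c b D E i j k p s q) ⟩
        h (p * b + s * D + q * E + (i * 1 + (j * a + (k * c + 0))))              ≤⟨ h-pairs p s q _ ⟩
        p + s + q + g (i * 1 + (j * a + (k * c + 0)))                            ≤⟨ +-monoʳ-≤ (p + s + q) (g-value i j k) ⟩
        p + s + q + (i + (j + k))                                                ≡⟨ count i j k p s q ⟩
        i + (j + (k + (p + (s + (q + 0)))))                                      ∎
        where
        open ≤-Reasoning
        reorder : ∀ a c b D E i j k p s q →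
          1 * i + (a * j + (c * k + (b * p + (D * s + (E * q + 0))))) ≡
          p * b + s * D + q * E + (i * 1 + (j * a + (k * c + 0)))
        reorder = solve-∀
        count : ∀ i j k p s q → p + s + q + (i + (j + k)) ≡ i + (j + (k + (p + (s + (q + 0)))))
        count = solve-∀

      -- After one D the remainder `z + w` is below `b`, so only small coins follow.
      h₅[2b] : h₅ (2 * b) ≡ suc (g (z + w))
      h₅[2b] = trans (cong h₅ 2b≡D+[z+w]) (h₅-D z+w<b)
        where
        2b≡D+[z+w] : 2 * b ≡ D + (z + w)
        2b≡D+[z+w] = trans (cong (b +_) (+-identityʳ b)) (trans 2b≡E+w (+-assoc D z w))

      D<2b : D < 2 * b
      D<2b = +-monoʳ-< b (subst (u <_) (sym (+-identityʳ b)) u<b)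

-- A common criterion for the three families

criterion : ∀ a c b D E (let C = 1 ∷ a ∷ c ∷ b ∷ D ∷ E ∷ []) {{S : IsSystem C}} →
  let instance
        a≢0 = coin-nonZero S (# 1)
        c≢0 = coin-nonZero S (# 2)
      g = spend c (spend a id)
  in ∀ u z w d ℓ → 0 < u → a ≡ u ⊎ a ≡ suc u →
  c ≡ a + u → D ≡ b + u → E ≡ b + u + z → b ≡ u + z + w →
  g w ≤ 1 → g (w + u) ≤ 1 → g (w + u + u) ≤ 1 →
  D + d ≡ ℓ * c → d < c → g d < ℓ → 1 < g (z + w) →
  Canonical C × Noncanonical (1 ∷ a ∷ c ∷ b ∷ D ∷ []) {{subsystem-isSystem (n≤1+n 5) S}}
criterion a c b D E {{S}} u z w d ℓ u>0 a≡ refl refl refl b≡ gw gwu gwuu D+d≡ d<c gd<ℓ 1<g = canonical , noncanonical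
  where
  instance
    a≢0 = coin-nonZero S (# 1)
    c≢0 = coin-nonZero S (# 2)
    b≢0 = coin-nonZero S (# 3)
    D≢0 = coin-nonZero S (# 4)
    E≢0 = coin-nonZero S (# 5)
    S₅ = subsystem-isSystem (n≤1+n 5) S
  C₅ = 1 ∷ a ∷ c ∷ b ∷ D ∷ []
  z>0 : 0 < z
  z>0 = +-cancelˡ-< D 0 z (subst (_< D + z) (sym (+-identityʳ D)) (IsSystem.increasing S {# 4} {# 5} ≤-refl))
  module T = ThreeCoins a u u>0 a≡
  module M = T.SixCoins b d ℓ D+d≡ gd<ℓ z w d<c z>0 b≡ gw gwu gwuu
  canonical : Canonical (1 ∷ a ∷ c ∷ b ∷ D ∷ E ∷ [])
  -- An optimum is the size of some representation `x`, and `h-value` bounds the greedy count by it.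
  canonical _ (_ , _ , ((x , refl , refl) , _) , k<grd) =
    <⇒≱ k<grd (subst (_≤ sum x) (sym (grd-spendAll (a ∷ c ∷ b ∷ D ∷ E ∷ []) _)) (M.h-value x))
  coins≤D : ∀ i → lookup C₅ i ≤ D
  coins≤D zero                         = <⇒≤ (IsSystem.increasing S₅ {# 0} {# 4} (s≤s z≤n))
  coins≤D (suc zero)                   = <⇒≤ (IsSystem.increasing S₅ {# 1} {# 4} (s≤s (s≤s z≤n)))
  coins≤D (suc (suc zero))             = <⇒≤ (IsSystem.increasing S₅ {# 2} {# 4} (s≤s (s≤s (s≤s z≤n))))
  coins≤D (suc (suc (suc zero)))       = M.b≤D
  coins≤D (suc (suc (suc (suc zero)))) = ≤-refl
  2b-opt : ∀ x → value C₅ x ≡ 2 * b → 2 ≤ sum x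
  -- A single coin is worth at most D, which is less than 2b.
  2b-opt x eq = *-cancelˡ-< D 1 (sum x) (begin-strict
    D * 1      ≡⟨ *-identityʳ D ⟩
    D          <⟨ M.D<2b ⟩
    2 * b      ≡⟨ eq ⟨
    value C₅ x ≤⟨ value-≤ C₅ x D coins≤D ⟩
    D * sum x  ∎)
    where open ≤-Reasoning
  value-2b : ∀ a c b D → 1 * 0 + (a * 0 + (c * 0 + (b * 2 + (D * 0 + 0)))) ≡ 2 * b
  value-2b = solve-∀
  noncanonical : Noncanonical C₅
  noncanonical = 2 * b , ≤-<-trans z≤n M.D<2b , 2
    , ((0 ∷ 0 ∷ 0 ∷ 2 ∷ 0 ∷ [] , value-2b a c b D , refl) , 2b-opt)
    , subst (2 <_) (sym (trans (grd-spendAll (a ∷ c ∷ b ∷ D ∷ []) (2 * b)) M.h₅[2b])) (s≤s 1<g)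

-- The multiple ℓ c and the hypotheses on its greedy count

module _ (n c : ℕ) .{{_ : NonZero c}} where

  private
    numerator : ℕ
    numerator = n + (c ∸ 1)

    c≡1+[c∸1] : c ≡ suc (c ∸ 1)
    c≡1+[c∸1] = sym (suc-pred c)

  n≤⌈n/c⌉*c : n ≤ ⌈ n / c ⌉ * c
  n≤⌈n/c⌉*c = +-cancelˡ-≤ (c ∸ 1) _ _ (begin
    c ∸ 1 + n                          ≡⟨ +-comm (c ∸ 1) n ⟩
    numerator                          ≡⟨ m≡m%n+[m/n]*n numerator c ⟩
    numerator % c + ⌈ n / c ⌉ * c      ≤⟨ +-monoˡ-≤ _ (<⇒≤pred (m%n<n numerator c)) ⟩
    c ∸ 1 + ⌈ n / c ⌉ * c              ∎)
    where open ≤-Reasoning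

  ⌈n/c⌉*c∸n<c : ⌈ n / c ⌉ * c ∸ n < c
  ⌈n/c⌉*c∸n<c = begin-strict
    ⌈ n / c ⌉ * c ∸ n  ≤⟨ ∸-monoˡ-≤ n (m/n*n≤m numerator c) ⟩
    n + (c ∸ 1) ∸ n    ≡⟨ m+n∸m≡n n (c ∸ 1) ⟩
    c ∸ 1              <⟨ ≤-reflexive (sym c≡1+[c∸1]) ⟩
    c                  ∎
    where open ≤-Reasoning

-- Each coin `a` stands for `a` ones and saves `a - 1` coins. The formula in (b) and (c) is
-- therefore one coin, for c₅, plus the greedy count of d = ℓ c₃ - c₅ in (1, a).
grd-two-coins : ∀ a .{{_ : NonZero a}} d → d + 1 ∸ (d / a) * (a ∸ 1) ≡ suc (spend a id d)
grd-two-coins a@(suc a-1) d = begin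
  d + 1 ∸ q * a-1                     ≡⟨ cong (λ y → y + 1 ∸ q * a-1) (m≡m%n+[m/n]*n d a) ⟩
  (d % a + q * a) + 1 ∸ q * a-1       ≡⟨ cong (_∸ q * a-1) (regroup (d % a) q a-1) ⟩
  suc (q + d % a) + q * a-1 ∸ q * a-1 ≡⟨ m+n∸n≡m _ (q * a-1) ⟩
  suc (q + d % a)                     ∎
  where
  open ≡-Reasoning
  q = d / a
  regroup : ∀ r q n → (r + q * suc n) + 1 ≡ suc (q + r) + q * n
  regroup = solve-∀

-- The three families

-- With u = 1, z = b - 1, w = 0 the exchange remainders are 0, 1, 2. The bound on `g d` is
-- automatic: `d < 3` costs at most one coin, while ℓ is at least 2. From `4 < b` the number z + w =
-- b - 1 exceeds the coin 3.
case-a : ∀ b {{S : IsSystem (1 ∷ 2 ∷ 3 ∷ b ∷ b + 1 ∷ 2 * b ∷ [])}} → 4 < b →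
  Canonical (1 ∷ 2 ∷ 3 ∷ b ∷ b + 1 ∷ 2 * b ∷ []) ×
  Noncanonical (1 ∷ 2 ∷ 3 ∷ b ∷ b + 1 ∷ []) {{subsystem-isSystem (n≤1+n 5) S}}
case-a b@(suc b-1) 4<b =
  criterion 2 3 b (b + 1) (2 * b) 1 b-1 0 d ℓ (s≤s z≤n) (inj₂ refl)
    refl refl (2b≡ b-1) (cong suc (sym (+-identityʳ b-1))) z≤n ≤-refl ≤-refl
    (m+[n∸m]≡n D≤3ℓ) d<3 (≤-<-trans (gd≤1 d d<3) 1<ℓ)
    (T.g>1 (subst (3 <_) (sym (+-identityʳ b-1)) (s≤s⁻¹ 4<b)))
  where
  module T = ThreeCoins 2 1 (s≤s z≤n) (inj₂ refl)
  ℓ = ⌈ b + 1 / 3 ⌉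
  d = ℓ * 3 ∸ (b + 1)
  D≤3ℓ : b + 1 ≤ ℓ * 3
  D≤3ℓ = n≤⌈n/c⌉*c (b + 1) 3
  d<3 : d < 3
  d<3 = ⌈n/c⌉*c∸n<c (b + 1) 3
  1<ℓ : 1 < ℓ
  1<ℓ = *-cancelʳ-< 3 1 ℓ (≤-trans (<⇒≤ 4<b) (≤-trans (m≤m+n b 1) D≤3ℓ))
  2b≡ : ∀ n → 2 * suc n ≡ suc n + 1 + n
  2b≡ = solve-∀
  gd≤1 : ∀ d → d < 3 → T.g d ≤ 1
  gd≤1 0 _ = z≤n
  gd≤1 1 _ = ≤-refl
  gd≤1 2 _ = ≤-refl
  gd≤1 (suc (suc (suc _))) (s≤s (s≤s (s≤s ())))

module _ (a c D : ℕ) .{{_ : NonZero a}} .{{_ : NonZero c}} where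

  -- The two hypotheses on the greedy count of ℓ c₃ combined into one inequality.
  GreedyBound : Set
  GreedyBound = let d = ⌈ D / c ⌉ * c ∸ D in d + 1 ∸ (d / a) * (a ∸ 1) ≤ ⌈ D / c ⌉

  -- Since `d < c`, greedy pays `d` with 1 and `a` alone, so the left side of the bound is one more
  -- than `g d`.
  greedyBound⇒g< : GreedyBound → spend c (spend a id) (⌈ D / c ⌉ * c ∸ D) < ⌈ D / c ⌉
  greedyBound⇒g< bound = subst (_≤ ⌈ D / c ⌉)
    (trans (grd-two-coins a _) (cong suc (sym (spend-< (spend a id) (⌈n/c⌉*c∸n<c D c))))) bound

-- With z = b - a and w = 1 the exchange remainders are 1, a, c. The bound `3 * a ≤ suc b` says
-- exactly that z + w exceeds c = 2a - 1, so it is not a single coin.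
case-b : ∀ u c b D E (let a = suc u; C = 1 ∷ a ∷ c ∷ b ∷ D ∷ E ∷ []) {{S : IsSystem C}} →
  c ≡ a + u → D ≡ b + u → suc E ≡ b + b → 3 * a ≤ suc b →
  GreedyBound a c D {{coin-nonZero S (# 1)}} {{coin-nonZero S (# 2)}} →
  Canonical C × Noncanonical (1 ∷ a ∷ c ∷ b ∷ D ∷ []) {{subsystem-isSystem (n≤1+n 5) S}}
case-b u c b D E {{S}} refl refl 1+E≡2b 3a≤1+b bound =
  criterion a c b D E u z 1 d ℓ u>0 (inj₂ refl)
    refl refl E≡ (trans b≡a+z (regroup₁ u z)) (T.g-+≤ 1 0) (≤-reflexive T.ga≡1) (≤-reflexive T.gc≡1)
    (m+[n∸m]≡n (n≤⌈n/c⌉*c D c)) (⌈n/c⌉*c∸n<c D c) (greedyBound⇒g< a c D bound)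
    (T.g>1 c<z+1)
  where
  instance
    c≢0 = coin-nonZero S (# 2)
  a = suc u
  ℓ = ⌈ D / c ⌉
  d = ℓ * c ∸ D
  u>0 : 0 < u
  u>0 = s≤s⁻¹ (IsSystem.increasing S {# 0} {# 1} (s≤s z≤n))
  module T = ThreeCoins a u u>0 (inj₂ refl)
  z = b ∸ a
  b≡a+z : b ≡ a + z
  b≡a+z = sym (m+[n∸m]≡n (<⇒≤ (IsSystem.increasing S {# 1} {# 3} (s≤s (s≤s z≤n)))))
  regroup₁ : ∀ u z → suc u + z ≡ u + z + 1
  regroup₁ = solve-∀
  regroup₂ : ∀ b u z → b + (suc u + z) ≡ suc (b + u + z)
  regroup₂ = solve-∀
  regroup₃ : ∀ u z → suc (suc u + z) ≡ suc u + suc z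
  regroup₃ = solve-∀
  regroup₄ : ∀ u → 3 * suc u ≡ suc u + (suc (suc u + u))
  regroup₄ = solve-∀
  E≡ : E ≡ b + u + z
  E≡ = suc-injective (trans 1+E≡2b (trans (cong (b +_) b≡a+z) (regroup₂ b u z)))
  c<z+1 : c < z + 1
  c<z+1 = subst (c <_) (+-comm 1 z) (+-cancelˡ-≤ a _ _
    (≤-trans (≤-reflexive (sym (regroup₄ u))) (≤-trans 3a≤1+b (≤-reflexive (trans (cong suc b≡a+z) (regroup₃ u z))))))

-- With u = a, z = b - a, w = 0 the exchange remainders are 0, a, c. Now z is at least c - 1, and z
-- = c is the excluded b = 3a, where greedy would pay 2b with the two coins D and c.
case-c : ∀ a c b D E (let C = 1 ∷ a ∷ c ∷ b ∷ D ∷ E ∷ []) {{S : IsSystem C}} →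
  c ≡ a + a → D ≡ b + a → E ≡ b + b → 3 * a ≤ suc b → b ≢ 3 * a →
  GreedyBound a c D {{coin-nonZero S (# 1)}} {{coin-nonZero S (# 2)}} →
  Canonical C × Noncanonical (1 ∷ a ∷ c ∷ b ∷ D ∷ []) {{subsystem-isSystem (n≤1+n 5) S}}
case-c zero _ _ _ _ {{S}} _ _ _ _ _ _ = ⊥-elim (n≮0 (IsSystem.increasing S {# 0} {# 1} (s≤s z≤n)))
case-c a@(suc a-1) c b D E {{S}} refl refl refl 3a≤1+b b≢3a bound =
  criterion a c b D E a z 0 d ℓ a>0 (inj₁ refl)
    refl refl (trans (cong (b +_) b≡a+z) (sym (+-assoc b a z))) (trans b≡a+z (sym (+-identityʳ (a + z))))
    (≤-trans (≤-reflexive T.g0≡0) z≤n) (≤-reflexive T.ga≡1) (≤-reflexive T.gc≡1)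
    (m+[n∸m]≡n (n≤⌈n/c⌉*c D c)) (⌈n/c⌉*c∸n<c D c) (greedyBound⇒g< a c D bound)
    (subst (λ y → 1 < T.g y) (sym (+-identityʳ z)) (1<g (m≤n⇒m<n∨m≡n c≤1+z)))
  where
  instance
    c≢0 = coin-nonZero S (# 2)
  ℓ = ⌈ D / c ⌉
  d = ℓ * c ∸ D
  1<a : 1 < a
  1<a = IsSystem.increasing S {# 0} {# 1} (s≤s z≤n)
  a>0 : 0 < a
  a>0 = s≤s z≤n
  module T = ThreeCoins a a a>0 (inj₁ refl)
  z = b ∸ a
  b≡a+z : b ≡ a + z
  b≡a+z = sym (m+[n∸m]≡n (<⇒≤ (IsSystem.increasing S {# 1} {# 3} (s≤s (s≤s z≤n)))))
  3a≡ : ∀ a → a + (a + a) ≡ 3 * a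
  3a≡ = solve-∀
  c≤1+z : c ≤ suc z
  c≤1+z = +-cancelˡ-≤ a _ _ (≤-trans (≤-reflexive (3a≡ a)) (≤-trans 3a≤1+b (≤-reflexive (trans (cong suc b≡a+z) (sym (+-suc a z))))))
  1<g : c < suc z ⊎ c ≡ suc z → 1 < T.g z
  1<g (inj₁ c<1+z) with m≤n⇒m<n∨m≡n (s≤s⁻¹ c<1+z)
  ... | inj₁ c<z = T.g>1 c<z
  ... | inj₂ c≡z = ⊥-elim (b≢3a (trans b≡a+z (trans (cong (a +_) (sym c≡z)) (3a≡ a))))
  -- Here z = c - 1 consists of one `a` and `a - 1` ones, which makes `a > 1` coins.
  1<g (inj₂ c≡1+z) = subst (1 <_) (sym (trans (cong T.g z≡) (T.g-middle ≤-refl))) 1<a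
    where
    z≡ : z ≡ a + a-1
    z≡ = trans (suc-injective (sym c≡1+z)) (+-suc a-1 a-1)

theorem10 : (c₂ c₃ c₄ c₅ c₆ : ℕ) →
  let C = 1 ∷ c₂ ∷ c₃ ∷ c₄ ∷ c₅ ∷ c₆ ∷ [] in
  {{isSystem : IsSystem C}} →
  let instance
        c₂-nonZero = coin-nonZero isSystem (# 1)
        c₃-nonZero = coin-nonZero isSystem (# 2)
      ℓ = ⌈ c₅ / c₃ ⌉
      d = ℓ * c₃ ∸ c₅
  in
  ( (C ≡ 1 ∷ 2 ∷ 3 ∷ c₄ ∷ c₄ + 1 ∷ 2 * c₄ ∷ []
      × c₄ > 4)
  ⊎ (C ≡ 1 ∷ c₂ ∷ 2 * c₂ ∸ 1 ∷ c₄ ∷ c₂ + c₄ ∸ 1 ∷ 2 * c₄ ∸ 1 ∷ []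
      × c₄ ≥ 3 * c₂ ∸ 1
      × grd C (ℓ * c₃) ≤ ℓ
      × grd C (ℓ * c₃) ≡ d + 1 ∸ (d / c₂) * (c₂ ∸ 1))
  ⊎ (C ≡ 1 ∷ c₂ ∷ 2 * c₂ ∷ c₄ ∷ c₂ + c₄ ∷ 2 * c₄ ∷ []
      × c₄ ≥ 3 * c₂ ∸ 1
      × c₄ ≢ 3 * c₂
      × grd C (ℓ * c₃) ≤ ℓ
      × grd C (ℓ * c₃) ≡ d + 1 ∸ (d / c₂) * (c₂ ∸ 1)) ) →
  Canonical C × Noncanonical (1 ∷ c₂ ∷ c₃ ∷ c₄ ∷ c₅ ∷ []) {{subsystem-isSystem (n≤1+n 5) isSystem}}
theorem10 _ _ b _ _ (inj₁ (refl , b>4)) = case-a b b>4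
theorem10 zero _ _ _ _ {{S}} (inj₂ (inj₁ _)) = ⊥-elim (n≮0 (IsSystem.increasing S {# 0} {# 1} (s≤s z≤n)))
theorem10 (suc u) c b D E {{S}} (inj₂ (inj₁ (refl , b≥ , grd≤ℓ , grd≡))) =
  -- The truncated subtractions of the statement are traded for successors on the other side.
  case-b u c b D E (2a∸1≡ u) (+-comm u b) (1+[2b∸1]≡2b b 0<b) (≤-trans (m≤n+m∸n (3 * suc u) 1) (s≤s b≥)) (≤-trans (≤-reflexive (sym grd≡)) grd≤ℓ)
  where
  2a∸1≡ : ∀ u → 2 * suc u ∸ 1 ≡ suc u + u
  2a∸1≡ u = trans (cong (u +_) (+-identityʳ (suc u))) (+-comm u (suc u))
  0<b : 0 < b
  0<b = ≤-<-trans z≤n (IsSystem.increasing S {# 0} {# 3} (s≤s z≤n))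
  1+[2b∸1]≡2b : ∀ b → 0 < b → suc (2 * b ∸ 1) ≡ b + b
  1+[2b∸1]≡2b (suc b) _ = cong (λ y → suc (b + y)) (+-identityʳ (suc b))
theorem10 a c b D E (inj₂ (inj₂ (refl , b≥ , b≢3a , grd≤ℓ , grd≡))) =
  case-c a c b D E (double a) (+-comm a b) (double b) (≤-trans (m≤n+m∸n (3 * a) 1) (s≤s b≥)) b≢3a (≤-trans (≤-reflexive (sym grd≡)) grd≤ℓ)
  where
  double : ∀ n → 2 * n ≡ n + n
  double = solve-∀
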